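{- Let $G$ and $H$ be controllable graphs on $n$ vertices with extended walk matrices $\widehat{W}_G$ and $\widehat{W}_H$. If there exists an $n\times n$ permutation matrix $P$ such that $P\widehat{W}_G=\widehat{W}_H$ (that is, the extended walk matrices are equal up to a permutation of the rows), then $G$ and $H$ are isomorphic.
   Context: All graphs are finite and simple. For a graph $G$ on $n$ vertices with adjacency matrix $A$, let $\mathbf{1}$ be the all-ones vector in $\mathbb{R}^n$. The walk matrix of $G$ is the $n\times n$ matrix $W_G=\big[\mathbf{1}\ \ A\mathbf{1}\ \cdots\ A^{n-1}\mathbf{1}\big]$, and $G$ is controllable if $W_G$ is invertible. The extended walk matrix of $G$ is the $n\times(n+1)$ matrix $\widehat{W}_G=\big[\mathbf{1}\ \ A\mathbf{1}\ \cdots\ A^{n}\mathbf{1}\big]$. -}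

module Defs where

open import Algebra.Bundles using (CommutativeRing)
open import Data.Bool.Base using (if_then_else_)
open import Data.Fin.Base using (Fin; toℕ)
open import Data.Fin.Permutation using (Permutation′; _⟨$⟩ʳ_)
open import Data.Fin.Properties using (_≟_)
open import Data.Nat.Base using (ℕ; zero; suc)
open import Data.Product.Base using (Σ-syntax; _×_)
open import Data.Rational.Base using (ℚ; 0ℚ; 1ℚ; _*_)
open import Data.Rational.Properties using (+-*-commutativeRing)
open import Data.Vec.Functional using (Vector; replicate)
open import Function.Bundles using (_⇔_)
open import Level using (0ℓ)
open import Relation.Binary.Core using (Rel)
open import Relation.Binary.Definitions using (Decidable; Irreflexive; Symmetric)
open import Relation.Binary.PropositionalEquality.Core using (_≡_)
open import Relation.Nullary.Decidable.Core using (does)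

open import Algebra.Properties.Semiring.Sum
  (CommutativeRing.semiring +-*-commutativeRing) using (sum)

private
  variable
    l m n : ℕ

-- Matrices are over ℚ rather than ℝ.  The matrices of a graph are integral, and
-- an integer matrix has an inverse over ℝ if and only if it has one over ℚ.

Matrix : ℕ → ℕ → Set
Matrix m n = Fin m → Fin n → ℚ

infix  4 _≋_
infixl 7 _·_ _·ᵥ_
infixr 8 _^ᴹ_

_≋_ : Rel (Matrix m n) 0ℓ
M ≋ N = ∀ i j → M i j ≡ N i j

𝕀 : Matrix n n
𝕀 i j = if does (i ≟ j) then 1ℚ else 0ℚ

_·_ : Matrix l m → Matrix m n → Matrix l n
(M · N) i k = sum λ j → M i j * N j k

_·ᵥ_ : Matrix m n → Vector ℚ n → Vector ℚ m
(M ·ᵥ v) i = sum λ j → M i j * v j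

_^ᴹ_ : Matrix n n → ℕ → Matrix n n
M ^ᴹ zero  = 𝕀
M ^ᴹ suc k = M · (M ^ᴹ k)

𝟏 : Vector ℚ n
𝟏 = replicate _ 1ℚ

Invertible : Matrix n n → Set
Invertible {n} M = Σ[ N ∈ Matrix n n ] (M · N ≋ 𝕀) × (N · M ≋ 𝕀)

-- The permutation matrices are the row permutations of the identity matrix.
IsPermutationMatrix : Matrix n n → Set
IsPermutationMatrix {n} P =
  Σ[ σ ∈ Permutation′ n ] (∀ i j → P i j ≡ 𝕀 (σ ⟨$⟩ʳ i) j)

-- Simple graphs with vertex set Fin n.  Decidability of adjacency is what makes
-- the adjacency matrix definable constructively.
record Graph (n : ℕ) : Set₁ where
  infix 4 _~_ _~?_
  field
    _~_      : Rel (Fin n) 0ℓ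
    _~?_     : Decidable _~_
    ~-sym    : Symmetric _~_
    ~-irrefl : Irreflexive _≡_ _~_

Isomorphic : Graph n → Graph n → Set
Isomorphic {n} G H =
  Σ[ σ ∈ Permutation′ n ] (∀ i j → (i G.~ j) ⇔ ((σ ⟨$⟩ʳ i) H.~ (σ ⟨$⟩ʳ j)))
  where
  module G = Graph G
  module H = Graph H

adjacencyMatrix : Graph n → Matrix n n
adjacencyMatrix G i j = if does (i ~? j) then 1ℚ else 0ℚ
  where open Graph G

-- The n × m matrix [ 𝟏  A𝟏  ⋯  A^(m-1)𝟏 ].
walks : Graph n → (m : ℕ) → Matrix n m
walks G m i k = ((adjacencyMatrix G ^ᴹ toℕ k) ·ᵥ 𝟏) i

walkMatrix : Graph n → Matrix n n
walkMatrix {n} G = walks G n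

extendedWalkMatrix : Graph n → Matrix n (suc n)
extendedWalkMatrix {n} G = walks G (suc n)

Controllable : Graph n → Set
Controllable G = Invertible (walkMatrix G)

{-# OPTIONS --safe #-}

-- Let A and B be the adjacency matrices of G and H, and let Q be the permutation
-- matrix.  Since A maps each column of the walk matrix of G to the next one, Q A Q⁻¹
-- maps the k-th column of Q Ŵ_G = Ŵ_H to its successor, as B does.  Hence Q A Q⁻¹ and
-- B agree on the columns of W_H, and as W_H is invertible they are equal.

module Submission where

open import Defs
open import Algebra.Bundles using (CommutativeRing)
open import Data.Bool.Base using (if_then_else_)
open import Data.Fin.Base using (Fin; zero; suc; toℕ; inject₁)
open import Data.Fin.Permutation using (Permutation′; _⟨$⟩ʳ_; _⟨$⟩ˡ_; flip; inverseʳ)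
open import Data.Fin.Properties using (_≟_; toℕ-inject₁)
open import Data.Nat.Base using (ℕ; suc)
open import Data.Product.Base using (Σ-syntax; _×_; _,_)
open import Data.Rational.Base using (ℚ; 0ℚ; 1ℚ; _+_; _*_)
open import Data.Rational.Properties
  using (+-*-commutativeRing; *-assoc; *-comm; *-identityˡ; *-zeroˡ; +-identityˡ; +-identityʳ)
open import Data.Vec.Functional using (Vector)
open import Function.Base using (const)
open import Function.Bundles using (_⇔_; mk⇔)
open import Relation.Binary.PropositionalEquality
open import Relation.Nullary.Decidable using (Dec; yes; no; does; does-⇔)
open import Relation.Nullary.Negation using (contradiction)

open import Algebra.Properties.Semiring.Sum
  (CommutativeRing.semiring +-*-commutativeRing)
  using (sum; sum-cong-≗; sum-replicate-zero; sum-permute; ∑-comm; *-distribˡ-sum; *-distribʳ-sum)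

open ≡-Reasoning

private
  variable
    l m n : ℕ

·ᵥ-congˡ : (M : Matrix m n) {v w : Vector ℚ n} → v ≗ w → M ·ᵥ v ≗ M ·ᵥ w
·ᵥ-congˡ M v≗w i = sum-cong-≗ λ j → cong (M i j *_) (v≗w j)

-- The two finite sums can be exchanged. Taking for `v` a column of a third matrix gives
-- associativity of `·` entrywise, since an entry of a product unfolds to `·ᵥ` applied to a column.
·ᵥ-assoc : (M : Matrix l m) (N : Matrix m n) (v : Vector ℚ n) →
  (M · N) ·ᵥ v ≗ M ·ᵥ (N ·ᵥ v)
·ᵥ-assoc M N v i = begin
  (sum λ k → (sum λ j → M i j * N j k) * v k)
    ≡⟨ sum-cong-≗ (λ k → *-distribʳ-sum (v k) (λ j → M i j * N j k)) ⟩
  (sum λ k → sum λ j → M i j * N j k * v k)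
    ≡⟨ ∑-comm (λ k j → M i j * N j k * v k) ⟩
  (sum λ j → sum λ k → M i j * N j k * v k)
    ≡⟨ sum-cong-≗ (λ j → sum-cong-≗ λ k → *-assoc (M i j) (N j k) (v k)) ⟩
  (sum λ j → sum λ k → M i j * (N j k * v k))
    ≡⟨ sum-cong-≗ (λ j → *-distribˡ-sum (M i j) (λ k → N j k * v k)) ⟨
  (sum λ j → M i j * (sum λ k → N j k * v k)) ∎

𝕀-·ᵥ : (v : Vector ℚ n) → 𝕀 ·ᵥ v ≗ v
𝕀-·ᵥ {suc n} v zero = begin
  1ℚ * v zero + (sum λ j → 0ℚ * v (suc j))
    ≡⟨ cong₂ _+_ (*-identityˡ (v zero)) (sum-cong-≗ λ j → *-zeroˡ (v (suc j))) ⟩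
  v zero + (sum {n} λ _ → 0ℚ)
    ≡⟨ cong (v zero +_) (sum-replicate-zero n) ⟩
  v zero + 0ℚ
    ≡⟨ +-identityʳ (v zero) ⟩
  v zero ∎
𝕀-·ᵥ {suc n} v (suc i) = begin
  -- `𝕀 (suc i) (suc j)` reduces to `𝕀 i j`, so the tail of the sum is the same statement one size
  -- down.
  0ℚ * v zero + (𝕀 ·ᵥ λ j → v (suc j)) i
    ≡⟨ cong₂ _+_ (*-zeroˡ (v zero)) (𝕀-·ᵥ (λ j → v (suc j)) i) ⟩
  0ℚ + v (suc i)
    ≡⟨ +-identityˡ (v (suc i)) ⟩
  v (suc i) ∎

𝕀-symmetric : (i j : Fin n) → 𝕀 i j ≡ 𝕀 j i
𝕀-symmetric i j =
  cong (λ b → if b then 1ℚ else 0ℚ) (does-⇔ (mk⇔ sym sym) (i ≟ j) (j ≟ i))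

·-identityʳ : (M : Matrix m n) → M · 𝕀 ≋ M
·-identityʳ M i k = begin
  (sum λ j → M i j * 𝕀 j k)
    ≡⟨ sum-cong-≗ (λ j → trans (*-comm (M i j) (𝕀 j k)) (cong (_* M i j) (𝕀-symmetric j k))) ⟩
  (sum λ j → 𝕀 k j * M i j)
    ≡⟨ 𝕀-·ᵥ (M i) k ⟩
  M i k ∎

·-cancelʳ : (W : Matrix n n) → Invertible W →
  (M N : Matrix m n) → M · W ≋ N · W → M ≋ N
·-cancelʳ W (W⁻¹ , WW⁻¹≋𝕀 , _) M N MW≋NW i k = begin
  M i k                ≡⟨ expand M ⟩
  ((M · W) · W⁻¹) i k  ≡⟨ sum-cong-≗ (λ j → cong (_* W⁻¹ j k) (MW≋NW i j)) ⟩
  ((N · W) · W⁻¹) i k  ≡⟨ expand N ⟨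
  N i k                ∎
  where
  expand : ∀ L → L i k ≡ ((L · W) · W⁻¹) i k
  expand L = begin
    L i k                ≡⟨ ·-identityʳ L i k ⟨
    (L · 𝕀) i k          ≡⟨ ·ᵥ-congˡ L (λ j → WW⁻¹≋𝕀 j k) i ⟨
    (L · (W · W⁻¹)) i k  ≡⟨ ·ᵥ-assoc L W (λ j → W⁻¹ j k) i ⟨
    ((L · W) · W⁻¹) i k  ∎

-- This is Q M Q⁻¹ for the permutation matrix Q with entries `𝕀 (σ ⟨$⟩ʳ i) j`.
conjugate : Permutation′ n → Matrix n n → Matrix n n
conjugate σ M i j = M (σ ⟨$⟩ʳ i) (σ ⟨$⟩ʳ j)

-- In matrix form, (Q M Q⁻¹)(Q v) = Q (M v); entrywise it is the reindexing of a sum along `σ`.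
conjugate-·ᵥ : (σ : Permutation′ n) (M : Matrix n n) (v : Vector ℚ n) →
  ∀ i → (conjugate σ M ·ᵥ λ j → v (σ ⟨$⟩ʳ j)) i ≡ (M ·ᵥ v) (σ ⟨$⟩ʳ i)
conjugate-·ᵥ σ M v i = sym (sum-permute (λ j → M (σ ⟨$⟩ʳ i) j * v j) σ)

adjacencyMatrix-·-walks : (G : Graph n) (m : ℕ) →
  ∀ i k → (adjacencyMatrix G · walks G m) i k ≡ walks G (suc m) i (suc k)
adjacencyMatrix-·-walks G m i k =
  sym (·ᵥ-assoc (adjacencyMatrix G) (adjacencyMatrix G ^ᴹ toℕ k) 𝟏 i)

walks-inject₁ : (G : Graph n) (m : ℕ) →
  ∀ i k → walks G (suc m) i (inject₁ k) ≡ walks G m i k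
walks-inject₁ G m i k =
  cong (λ r → ((adjacencyMatrix G ^ᴹ r) ·ᵥ 𝟏) i) (toℕ-inject₁ k)

adjacencyMatrix-determined : (G H : Graph n) → Controllable H → (σ : Permutation′ n) →
  (∀ i k → extendedWalkMatrix G (σ ⟨$⟩ʳ i) k ≡ extendedWalkMatrix H i k) →
  conjugate σ (adjacencyMatrix G) ≋ adjacencyMatrix H
adjacencyMatrix-determined {n} G H controllable σ Ŵ-eq =
  ·-cancelʳ (walkMatrix H) controllable (conjugate σ A) B λ i k → begin
    (conjugate σ A · walkMatrix H) i k
      ≡⟨ ·ᵥ-congˡ (conjugate σ A) (λ j → W-eq j k) i ⟨
    (conjugate σ A ·ᵥ λ j → walkMatrix G (σ ⟨$⟩ʳ j) k) i
      ≡⟨ conjugate-·ᵥ σ A (λ j → walkMatrix G j k) i ⟩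
    (A · walkMatrix G) (σ ⟨$⟩ʳ i) k
      ≡⟨ adjacencyMatrix-·-walks G n (σ ⟨$⟩ʳ i) k ⟩
    extendedWalkMatrix G (σ ⟨$⟩ʳ i) (suc k)
      -- For the last `k` this compares the columns of n-step walks, which lie in the extended walk
      -- matrices but not in the walk matrices.
      ≡⟨ Ŵ-eq i (suc k) ⟩
    extendedWalkMatrix H i (suc k)
      ≡⟨ adjacencyMatrix-·-walks H n i k ⟨
    (B · walkMatrix H) i k ∎
  where
  A = adjacencyMatrix G
  B = adjacencyMatrix H

  W-eq : ∀ j k → walkMatrix G (σ ⟨$⟩ʳ j) k ≡ walkMatrix H j k
  W-eq j k = begin
    walkMatrix G (σ ⟨$⟩ʳ j) k                    ≡⟨ walks-inject₁ G n (σ ⟨$⟩ʳ j) k ⟨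
    extendedWalkMatrix G (σ ⟨$⟩ʳ j) (inject₁ k)  ≡⟨ Ŵ-eq j (inject₁ k) ⟩
    extendedWalkMatrix H j (inject₁ k)           ≡⟨ walks-inject₁ H n j k ⟩
    walkMatrix H j k                             ∎

-- If the two decisions differed, the equation would identify `1ℚ` with `0ℚ`.
indicator-injective : {A B : Set} (a? : Dec A) (b? : Dec B) →
  (if does a? then 1ℚ else 0ℚ) ≡ (if does b? then 1ℚ else 0ℚ) → A ⇔ B
indicator-injective (yes a) (yes b) _ = mk⇔ (const b) (const a)
indicator-injective (no ¬a) (no ¬b) _ =
  mk⇔ (λ a → contradiction a ¬a) (λ b → contradiction b ¬b)
indicator-injective (yes _) (no _) ()
indicator-injective (no _) (yes _) ()

conjugate⇒Isomorphic : (G H : Graph n) (σ : Permutation′ n) →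
  conjugate σ (adjacencyMatrix G) ≋ adjacencyMatrix H → Isomorphic G H
-- `σ` sends vertices of `H` to vertices of `G`, so the isomorphism from `G` to `H` is its inverse.
conjugate⇒Isomorphic G H σ A≋B = flip σ , λ i j →
  indicator-injective (Graph._~?_ G i j) (Graph._~?_ H (σ ⟨$⟩ˡ i) (σ ⟨$⟩ˡ j))
    (trans (sym (cong₂ (adjacencyMatrix G) (inverseʳ σ) (inverseʳ σ)))
           (A≋B (σ ⟨$⟩ˡ i) (σ ⟨$⟩ˡ j)))

mainTheorem3 : (n : ℕ) (G H : Graph n) → Controllable G → Controllable H →
    (Σ[ P ∈ Matrix n n ] IsPermutationMatrix P × (P · extendedWalkMatrix G ≋ extendedWalkMatrix H)) →
    Isomorphic G H
mainTheorem3 n G H _ controllable (P , (σ , P≡𝕀σ) , PŴ≋Ŵ) =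
  conjugate⇒Isomorphic G H σ (adjacencyMatrix-determined G H controllable σ Ŵ-eq)
  where
  -- Row `i` of `P` is row `σ ⟨$⟩ʳ i` of the identity, so multiplying by `P` on the left selects
  -- that row of the extended walk matrix.
  Ŵ-eq : ∀ i k → extendedWalkMatrix G (σ ⟨$⟩ʳ i) k ≡ extendedWalkMatrix H i k
  Ŵ-eq i k = begin
    extendedWalkMatrix G (σ ⟨$⟩ʳ i) k
      ≡⟨ 𝕀-·ᵥ (λ j → extendedWalkMatrix G j k) (σ ⟨$⟩ʳ i) ⟨
    (𝕀 · extendedWalkMatrix G) (σ ⟨$⟩ʳ i) k
      ≡⟨ sum-cong-≗ (λ j → cong (_* extendedWalkMatrix G j k) (P≡𝕀σ i j)) ⟨
    (P · extendedWalkMatrix G) i k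
      ≡⟨ PŴ≋Ŵ i k ⟩
    extendedWalkMatrix H i k ∎
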